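{- Let $f,g:\{0,1\}^n\to\{0,1\}$ be Boolean functions. If $f$ is PN-equivalent to $g$, then $s(f)=s(g)$, $s^0(f)=s^0(g)$ and $s^1(f)=s^1(g)$. (Contrapositive: if $s(f)\neq s(g)$, or $s^0(f)\neq s^0(g)$, or $s^1(f)\neq s^1(g)$, then $f$ is not PN-equivalent to $g$.)
   Context: For a word $x=(x_1,\dots,x_n)\in\{0,1\}^n$ and an index $i$, $x^i$ denotes the word obtained from $x$ by changing (flipping) its $i$-th bit. The (local) sensitivity of $f$ on $x$ is $s(f,x)=|\{i\in\{1,\dots,n\}: f(x)\neq f(x^i)\}|$. Define $s(f)=\max\{s(f,x):x\in\{0,1\}^n\}$ (sensitivity), $s^0(f)=\max\{s(f,x):x\in\{0,1\}^n, f(x)=0\}$ (0-sensitivity) and $s^1(f)=\max\{s(f,x):x\in\{0,1\}^n, f(x)=1\}$ (1-sensitivity), with the convention that the maximum over the empty set is $0$. PN-equivalence: $f$ is PN-equivalent to $g$ if there exist a permutation $\pi$ of the $n$ coordinates (acting on words by permuting their bits) and, for each coordinate $j$, a choice of whether or not to negate it (written $(\neg)x_j$, the choice being independent of $x$), such that $f(\pi((\neg)x_1,(\neg)x_2,\dots,(\neg)x_n))=g(x_1,\dots,x_n)$ for all $x\in\{0,1\}^n$. -}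

module Defs where

open import Data.Bool using (Bool; true; false; not; if_then_else_)
open import Data.Bool.Properties using (_≟_)
open import Data.Fin using (Fin)
open import Data.Fin.Permutation using (Permutation′; _⟨$⟩ʳ_)
open import Data.Fin.Subset using (Subset)
open import Data.List using (List; []; _∷_; _++_; map; filter; length; allFin)
open import Data.List.Extrema.Nat using (max)
open import Data.List.Membership.Propositional using (_∈_)
open import Data.List.Membership.Propositional.Properties using (∈-map⁺; ∈-++⁺ˡ; ∈-++⁺ʳ)
open import Data.List.Relation.Unary.Any using (here)
open import Data.Nat using (ℕ; zero; suc)
open import Data.Product using (Σ-syntax)
open import Data.Vec using (Vec; []; _∷_; lookup; tabulate; updateAt)
open import Relation.Binary.PropositionalEquality using (_≡_; refl)
open import Relation.Nullary.Decidable using (¬?)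

Word : ℕ → Set
Word n = Vec Bool n

BoolFun : ℕ → Set
BoolFun n = Word n → Bool

flipBit : ∀ {n} → Word n → Fin n → Word n
flipBit x i = updateAt x i not

allWords : ∀ n → List (Word n)
allWords zero    = [] ∷ []
allWords (suc n) = map (false ∷_) (allWords n) ++ map (true ∷_) (allWords n)

∈-allWords : ∀ {n} (x : Word n) → x ∈ allWords n
∈-allWords []          = here refl
∈-allWords (false ∷ x) = ∈-++⁺ˡ (∈-map⁺ (false ∷_) (∈-allWords x))
∈-allWords (true ∷ x)  = ∈-++⁺ʳ (map (false ∷_) (allWords _)) (∈-map⁺ (true ∷_) (∈-allWords x))

localSensitivity : ∀ {n} → BoolFun n → Word n → ℕ
localSensitivity {n} f x = length (filter (λ i → ¬? (f x ≟ f (flipBit x i))) (allFin n))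

-- The default value 0 of `max` is the convention max ∅ = 0; it does not
-- affect maxima of non-empty lists of natural numbers.
sensitivity : ∀ {n} → BoolFun n → ℕ
sensitivity {n} f = max 0 (map (localSensitivity f) (allWords n))

sensitivityAt : ∀ {n} → Bool → BoolFun n → ℕ
sensitivityAt {n} b f =
  max 0 (map (localSensitivity f) (filter (λ x → f x ≟ b) (allWords n)))

sensitivity⁰ : ∀ {n} → BoolFun n → ℕ
sensitivity⁰ = sensitivityAt false

sensitivity¹ : ∀ {n} → BoolFun n → ℕ
sensitivity¹ = sensitivityAt true

permute : ∀ {n} → Permutation′ n → Word n → Word n
permute π x = tabulate (λ i → lookup x (π ⟨$⟩ʳ i))

-- Negates exactly the coordinates belonging to N.
negateOn : ∀ {n} → Subset n → Word n → Word n
negateOn N x = tabulate (λ j → if lookup N j then not (lookup x j) else lookup x j)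

PNEquivalent : ∀ {n} → BoolFun n → BoolFun n → Set
PNEquivalent {n} f g =
  Σ[ π ∈ Permutation′ n ] Σ[ N ∈ Subset n ] (∀ x → f (permute π (negateOn N x)) ≡ g x)

{-# OPTIONS --safe #-}
-- Write φ for the map x ↦ π((¬)x₁,…,(¬)xₙ), so that f ∘ φ = g.  Flipping bit
-- π(k) of x flips bit k of φ(x), so π matches the sensitive indices of f at
-- φ(x) with those of g at x: the local sensitivities agree and f(φ(x)) = g(x).
-- Hence each sensitivity of g is at most that of f, and equality follows because
-- PN-equivalence is symmetric.
module Submission where

open import Defs
open import Data.Bool using (Bool; true; false; not; if_then_else_)
import Data.Bool.Properties as Bool
open import Data.Fin using (Fin; _≟_)
open import Data.Fin.Permutation using (Permutation′; _⟨$⟩ʳ_; _⟨$⟩ˡ_; inverseˡ; inverseʳ; flip)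
open import Data.Fin.Subset using (Subset)
open import Data.List using (List; []; _∷_; map; filter; length; allFin)
open import Data.List.Extrema.Nat using (max; max-mono-⊆)
open import Data.List.Membership.Propositional using (_∈_)
open import Data.List.Membership.Propositional.Properties
  using (∈-map⁺; ∈-map⁻; ∈-filter⁺; ∈-filter⁻; ∈-allFin)
open import Data.List.Membership.Propositional.Properties.WithK using (unique∧set⇒bag)
open import Data.List.Properties using (filter-≐)
open import Data.List.Relation.Binary.BagAndSetEquality using (∼bag⇒↭)
open import Data.List.Relation.Binary.Permutation.Propositional using (_↭_)
open import Data.List.Relation.Binary.Permutation.Propositional.Properties
  using (filter-↭; ↭-length)
open import Data.List.Relation.Unary.Unique.Propositional.Properties using (map⁺; allFin⁺)
open import Data.Nat using (ℕ; suc; _≤_; z≤n)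
open import Data.Nat.Properties using (≤-antisym)
open import Data.Product using (_×_; _,_)
open import Data.Sum using (_⊎_; inj₁; inj₂)
open import Data.Vec using (lookup; tabulate)
open import Data.Vec.Properties
  using (lookup∘tabulate; tabulate∘lookup; tabulate-cong; lookup∘updateAt; lookup∘updateAt′)
open import Function using (_∘_; mk⇔; Injection)
open import Function.Properties.Inverse using (↔⇒↣)
open import Level using (Level)
open import Relation.Binary.PropositionalEquality
  using (_≡_; _≢_; refl; sym; trans; cong; cong₂; subst; module ≡-Reasoning)
open import Relation.Nullary using (¬_; yes; no; does)
open import Relation.Nullary.Decidable using (¬?)
open import Relation.Unary using (Pred; Decidable)

private
  variable
    a b p : Level
    A : Set a
    B : Set b
    n : ℕ

length-filter-map : {P : Pred B p} (P? : Decidable P) (h : A → B) (xs : List A) →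
  length (filter P? (map h xs)) ≡ length (filter (P? ∘ h) xs)
length-filter-map P? h []       = refl
length-filter-map P? h (x ∷ xs) with does (P? (h x))
... | true  = cong suc (length-filter-map P? h xs)
... | false = length-filter-map P? h xs

permutation-injective : (π : Permutation′ n) {i j : Fin n} → π ⟨$⟩ʳ i ≡ π ⟨$⟩ʳ j → i ≡ j
permutation-injective π = Injection.injective (↔⇒↣ π)

-- Neither list has duplicates, the left one because `π` is injective, so having the same members
-- already makes them equal as bags.
map-permutation-allFin-↭ : (π : Permutation′ n) → map (π ⟨$⟩ʳ_) (allFin n) ↭ allFin n
map-permutation-allFin-↭ {n} π = ∼bag⇒↭ (unique∧set⇒bag
  (map⁺ (permutation-injective π) (allFin⁺ n)) (allFin⁺ n)
  (mk⇔ (λ _ → ∈-allFin _)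
       -- Surjectivity: an index `j` is the image of `π ⟨$⟩ˡ j`.
       (λ _ → subst (_∈ map (π ⟨$⟩ʳ_) (allFin n)) (inverseʳ π)
                (∈-map⁺ (π ⟨$⟩ʳ_) (∈-allFin _)))))

lookup-extensional : {x y : Word n} → (∀ i → lookup x i ≡ lookup y i) → x ≡ y
lookup-extensional {x = x} {y} x≗y = begin
  x                    ≡⟨ tabulate∘lookup x ⟨
  tabulate (lookup x)  ≡⟨ tabulate-cong x≗y ⟩
  tabulate (lookup y)  ≡⟨ tabulate∘lookup y ⟩
  y                    ∎
  where open ≡-Reasoning

-- Exclusive or, written so as to unfold to the branch inside `negateOn`; `lookup-transform` can
-- then state a bit of the transformed word without a conversion lemma.
negateIf : Bool → Bool → Bool
negateIf c d = if c then not d else d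

negateIf-not : ∀ c d → negateIf c (not d) ≡ not (negateIf c d)
negateIf-not true  d = refl
negateIf-not false d = refl

negateIf-involutive : ∀ c d → negateIf c (negateIf c d) ≡ d
negateIf-involutive true  d = Bool.not-involutive d
negateIf-involutive false d = refl

module _ (π : Permutation′ n) (N : Subset n) where

  transform : Word n → Word n
  transform x = permute π (negateOn N x)

  lookup-transform : ∀ x i →
    lookup (transform x) i ≡ negateIf (lookup N (π ⟨$⟩ʳ i)) (lookup x (π ⟨$⟩ʳ i))
  lookup-transform x i = trans (lookup∘tabulate _ i) (lookup∘tabulate _ (π ⟨$⟩ʳ i))

  -- Position `i` of `transform x` depends on `x` only through its bit `π ⟨$⟩ʳ i`. For `i = k` that
  -- bit is the flipped one, and a flip commutes with the optional negation; for `i ≢ k` injectivity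
  -- of `π` keeps it away from the flip.
  transform-flipBit : ∀ x k → transform (flipBit x (π ⟨$⟩ʳ k)) ≡ flipBit (transform x) k
  transform-flipBit x k = lookup-extensional bit
    where
    open ≡-Reasoning
    bit : ∀ i → lookup (transform (flipBit x (π ⟨$⟩ʳ k))) i ≡ lookup (flipBit (transform x) k) i
    bit i with i ≟ k
    ... | yes refl = begin
      lookup (transform (flipBit x πi)) i                ≡⟨ lookup-transform (flipBit x πi) i ⟩
      negateIf (lookup N πi) (lookup (flipBit x πi) πi)  ≡⟨ cong (negateIf (lookup N πi)) (lookup∘updateAt πi x) ⟩
      negateIf (lookup N πi) (not (lookup x πi))         ≡⟨ negateIf-not (lookup N πi) _ ⟩
      not (negateIf (lookup N πi) (lookup x πi))         ≡⟨ cong not (lookup-transform x i) ⟨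
      not (lookup (transform x) i)                       ≡⟨ lookup∘updateAt i (transform x) ⟨
      lookup (flipBit (transform x) i) i                 ∎
      where πi = π ⟨$⟩ʳ i
    ... | no i≢k = begin
      lookup (transform (flipBit x πk)) i                ≡⟨ lookup-transform (flipBit x πk) i ⟩
      negateIf (lookup N πi) (lookup (flipBit x πk) πi)  ≡⟨ cong (negateIf (lookup N πi))
                                                              (lookup∘updateAt′ πi πk πi≢πk x) ⟩
      negateIf (lookup N πi) (lookup x πi)               ≡⟨ lookup-transform x i ⟨
      lookup (transform x) i                             ≡⟨ lookup∘updateAt′ i k i≢k (transform x) ⟨
      lookup (flipBit (transform x) k) i                 ∎
      where
      πi = π ⟨$⟩ʳ i
      πk = π ⟨$⟩ʳ k
      πi≢πk = i≢k ∘ permutation-injective π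

  -- An index `k` is sensitive for `f` at `transform x` exactly when `π ⟨$⟩ʳ k` is sensitive for `g`
  -- at `x`. Counting such `k` is counting over the list of all indices rearranged by `π`, and a
  -- count ignores order.
  localSensitivity-transform : (f g : BoolFun n) → (∀ x → f (transform x) ≡ g x) →
    ∀ x → localSensitivity f (transform x) ≡ localSensitivity g x
  localSensitivity-transform f g fφ≡g x = begin
    length (filter sensitiveᶠ? (allFin n))
      -- Sensitivity is an inequality, so each inclusion carries an assumed equality `e` back to the
      -- other function and refutes it with `s`.
      ≡⟨ cong length (filter-≐ sensitiveᶠ? (sensitiveᵍ? ∘ (π ⟨$⟩ʳ_))
           ( (λ {k} s e → s (trans (fφ≡g x) (trans e (sym (flipped k)))))
           , (λ {k} s e → s (trans (sym (fφ≡g x)) (trans e (flipped k))))) (allFin n)) ⟩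
    length (filter (sensitiveᵍ? ∘ (π ⟨$⟩ʳ_)) (allFin n))
      ≡⟨ length-filter-map sensitiveᵍ? (π ⟨$⟩ʳ_) (allFin n) ⟨
    length (filter sensitiveᵍ? (map (π ⟨$⟩ʳ_) (allFin n)))
      ≡⟨ ↭-length (filter-↭ sensitiveᵍ? (map-permutation-allFin-↭ π)) ⟩
    length (filter sensitiveᵍ? (allFin n)) ∎
    where
    open ≡-Reasoning
    sensitiveᶠ? : Decidable (λ k → f (transform x) ≢ f (flipBit (transform x) k))
    sensitiveᶠ? k = ¬? (f (transform x) Bool.≟ f (flipBit (transform x) k))
    sensitiveᵍ? : Decidable (λ i → g x ≢ g (flipBit x i))
    sensitiveᵍ? i = ¬? (g x Bool.≟ g (flipBit x i))
    flipped : ∀ k → f (flipBit (transform x) k) ≡ g (flipBit x (π ⟨$⟩ʳ k))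
    flipped k = trans (cong f (sym (transform-flipBit x k))) (fφ≡g _)

-- The backward map is a right inverse of the forward one: evaluating the hypothesis at the backward
-- image of `x` turns the value of `g` there into `f x`.
PNEquivalent-sym : {f g : BoolFun n} → PNEquivalent f g → PNEquivalent g f
PNEquivalent-sym {n} {f} {g} (π , N , fφ≡g) =
  flip π , N′ , λ x → trans (sym (fφ≡g _)) (cong f (lookup-extensional (bit x)))
  where
  open ≡-Reasoning
  N′ : Subset n
  -- Negation comes before permutation in `transform`, so the backward map negates bit `k` before
  -- moving it to position `π ⟨$⟩ʳ k`. The set must therefore contain `k` exactly when `N` contains
  -- `π ⟨$⟩ʳ k`; the two negations then cancel.
  N′ = permute π N
  bit : ∀ x k → lookup (transform π N (transform (flip π) N′ x)) k ≡ lookup x k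
  bit x k = begin
    lookup (transform π N (transform (flip π) N′ x)) k
      ≡⟨ lookup-transform π N (transform (flip π) N′ x) k ⟩
    negateIf (lookup N πk) (lookup (transform (flip π) N′ x) πk)
      ≡⟨ cong (negateIf (lookup N πk)) (lookup-transform (flip π) N′ x πk) ⟩
    negateIf (lookup N πk) (negateIf (lookup N′ (π ⟨$⟩ˡ πk)) (lookup x (π ⟨$⟩ˡ πk)))
      ≡⟨ cong (negateIf (lookup N πk)) (cong₂ negateIf
           (trans (lookup∘tabulate (lookup N ∘ (π ⟨$⟩ʳ_)) (π ⟨$⟩ˡ πk)) (cong (lookup N) (inverseʳ π)))
           (cong (lookup x) (inverseˡ π))) ⟩
    negateIf (lookup N πk) (negateIf (lookup N πk) (lookup x k))
      ≡⟨ negateIf-involutive (lookup N πk) _ ⟩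
    lookup x k ∎
    where πk = π ⟨$⟩ʳ k

-- Every value `u x` on the left occurs on the right as `v (h x)`, so the maxima compare by
-- inclusion of the lists of values.
max-map-mono : (u v : A → ℕ) (h : A → A) (xs ys : List A) →
  (∀ x → v (h x) ≡ u x) → (∀ {x} → x ∈ xs → h x ∈ ys) →
  max 0 (map u xs) ≤ max 0 (map v ys)
-- `z≤n` compares the two default values 0, which also covers an empty `xs`, as when `g` never takes
-- the value `c` in `sensitivityAt-mono`.
max-map-mono u v h xs ys vh≡u h∈ys = max-mono-⊆ z≤n included
  where
  included : ∀ {m} → m ∈ map u xs → m ∈ map v ys
  included m∈ with ∈-map⁻ u m∈
  ... | x , x∈xs , refl = subst (_∈ map v ys) (vh≡u x) (∈-map⁺ v (h∈ys x∈xs))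

module _ {f g : BoolFun n} where

  sensitivity-mono : PNEquivalent f g → sensitivity g ≤ sensitivity f
  sensitivity-mono (π , N , fφ≡g) =
    max-map-mono _ _ (transform π N) (allWords n) (allWords n)
      (localSensitivity-transform π N f g fφ≡g) (λ _ → ∈-allWords _)

  sensitivityAt-mono : ∀ c → PNEquivalent f g → sensitivityAt c g ≤ sensitivityAt c f
  sensitivityAt-mono c (π , N , fφ≡g) =
    max-map-mono _ _ (transform π N) _ _ (localSensitivity-transform π N f g fφ≡g) preserved
    where
    preserved : ∀ {x} → x ∈ filter (λ x → g x Bool.≟ c) (allWords n) →
      transform π N x ∈ filter (λ x → f x Bool.≟ c) (allWords n)
    preserved {x} x∈ with ∈-filter⁻ (λ x → g x Bool.≟ c) {xs = allWords n} x∈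
    -- The transformation respects the split by output value: `f` at the image of `x` equals `g x`,
    -- hence `c`.
    ... | _ , gx≡c = ∈-filter⁺ (λ x → f x Bool.≟ c) (∈-allWords _) (trans (fφ≡g x) gx≡c)

module _ {f g : BoolFun n} (f~g : PNEquivalent f g) where

  private
    g~f : PNEquivalent g f
    g~f = PNEquivalent-sym f~g

  sensitivity-invariant : sensitivity f ≡ sensitivity g
  sensitivity-invariant = ≤-antisym (sensitivity-mono g~f) (sensitivity-mono f~g)

  sensitivityAt-invariant : ∀ c → sensitivityAt c f ≡ sensitivityAt c g
  sensitivityAt-invariant c = ≤-antisym (sensitivityAt-mono c g~f) (sensitivityAt-mono c f~g)

mainTheorem1 : (n : ℕ) (f g : BoolFun n) →
    (PNEquivalent f g →
    sensitivity f ≡ sensitivity g × sensitivity⁰ f ≡ sensitivity⁰ g × sensitivity¹ f ≡ sensitivity¹ g)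
    × (sensitivity f ≢ sensitivity g ⊎ sensitivity⁰ f ≢ sensitivity⁰ g ⊎ sensitivity¹ f ≢ sensitivity¹ g →
    ¬ PNEquivalent f g)
mainTheorem1 n f g =
  (λ f~g → sensitivity-invariant f~g , sensitivityAt-invariant f~g false , sensitivityAt-invariant f~g true) ,
  λ { (inj₁ s≢)        f~g → s≢ (sensitivity-invariant f~g)
    ; (inj₂ (inj₁ s≢)) f~g → s≢ (sensitivityAt-invariant f~g false)
    ; (inj₂ (inj₂ s≢)) f~g → s≢ (sensitivityAt-invariant f~g true) }
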